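{- Let $\mathcal P$ be a chiral or directly regular $n$-polytope of type $\{p_1, \ldots, p_{n-1}\}$, and suppose that $n$ is even, $n\ge 4$. Let $m = n/2$, and suppose that $p_{m-1}$ and $p_{m+1}$ are relatively prime, and that $p_m \geq 3$. Then $\mathcal P \diamond \mathcal P^{\delta}$ is not a polytope.
   Context: An abstract polytope of rank $n$ (an $n$-polytope) is a ranked poset of faces with ranks from $-1$ to $n$, with a unique least face (rank $-1$) and a unique greatest face (rank $n$), in which every flag (maximal chain) has $n+2$ faces, which satisfies the diamond condition (whenever $F<G$ with ranks $j-1$ and $j+1$ there are exactly two $j$-faces strictly between them), and which is strongly flag-connected (any two flags $\Phi,\Psi$ are joined by a sequence of flags, consecutive ones adjacent, all containing $\Phi\cap\Psi$; two flags are adjacent if they differ in exactly one face). $\Phi^j$ denotes the unique flag differing from $\Phi$ only in its $j$-face, and $\Phi^{i,j}=(\Phi^i)^j$. Each polytope considered has a fixed base flag $\Phi$. $\mathcal P$ is regular if its automorphism group $\Gamma(\mathcal P)$ is transitive on flags; then $\Gamma(\mathcal P)$ is generated by $\rho_0,\dots,\rho_{n-1}$, where $\rho_i$ maps $\Phi$ to $\Phi^i$. Put $\sigma_i=\rho_{i-1}\rho_i$ and $\Gamma^+(\mathcal P)=\langle\sigma_1,\dots,\sigma_{n-1}\rangle$; $\mathcal P$ is directly regular if it is regular and $\Gamma^+(\mathcal P)$ has index $2$ in $\Gamma(\mathcal P)$. $\mathcal P$ is chiral if $\Gamma(\mathcal P)$ has exactly two orbits on flags and adjacent flags lie in distinct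 orbits; then $\Gamma^+(\mathcal P):=\Gamma(\mathcal P)$ is generated by $\sigma_1,\dots,\sigma_{n-1}$, where $\sigma_i$ maps $\Phi$ to $\Phi^{i,i-1}$. In both cases $(\sigma_i\cdots\sigma_j)^2=1$ for $i<j$, and the type of $\mathcal P$ is $\{p_1,\dots,p_{n-1}\}$ where $p_i$ (with $2\le p_i\le\infty$) is the order of $\sigma_i$. Dual: $\mathcal P^\delta$ is $\mathcal P$ with reversed order; $\Gamma^+(\mathcal P^\delta)$ is the same group with specified generators $\sigma_i'=\sigma_{n-i}^{ -1}$, $i=1,\dots,n-1$. Intersection property: for a group $G$ with specified generators $\sigma_1,\dots,\sigma_{n-1}$, put $\tau_{i,j}=\sigma_i\cdots\sigma_j$ ($1\le i\le j\le n-1$) and, for $I\subseteq\{0,\dots,n-1\}$, $G_I=\langle\tau_{i,j}\mid i\le j,\ i-1,j\in I\rangle$. $G$ has the intersection property if $G_I\cap G_J=G_{I\cap J}$ for all $I,J$. Mix: $\Gamma^+(\mathcal P)\diamond\Gamma^+(\mathcal Q)$ is the subgroup of $\Gamma^+(\mathcal P)\times\Gamma^+(\mathcal Q)$ generated by $\beta_i=(\sigma_i,\sigma_i')$, where $\sigma_i,\sigma_i'$ are the specified generators of the two groups. $\mathcal P\diamond\mathcal Q$ is the flag-connected pre-polytope (polytope axioms with strong flag-connectedness weakened to flag-connectedness) built from this group, with $\Gamma^+(\mathcal P\diamond\mathcal Q)=\Gamma^+(\mathcal P)\diamond\Gamma^+(\mathcal Q)$; it is a polytope if and only if this group with generators $\beta_i$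 has the intersection property. -}

module Defs where

open import Level using (Level; _⊔_) renaming (suc to lsuc)
open import Algebra.Bundles using (Group)
import Algebra.Construct.DirectProduct as DirectProduct
import Algebra.Definitions.RawMonoid as RawMonoidDefs
import Algebra.Properties.Group as GroupProperties
open import Data.Empty using (⊥)
open import Data.Fin.Base as Fin using (Fin; toℕ; fromℕ; opposite)
open import Data.Fin.Properties using (opposite-prop; opposite-involutive)
open import Data.List.Base using (List)
open import Data.List.Relation.Unary.All using (All)
open import Data.List.Relation.Unary.AllPairs using (AllPairs)
open import Data.Nat.Base as ℕ using (ℕ; zero; suc; _∸_)
open import Data.Nat.Coprimality using (Coprime)
import Data.Nat.Properties as ℕₚ
open import Data.Product.Base using (Σ; ∃; ∃₂; _×_; _,_; proj₁; proj₂)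
open import Data.Sum.Base using (_⊎_)
open import Function.Base using (flip)
open import Function.Bundles using (Inverse)
open import Relation.Binary.Bundles using (Setoid)
open import Relation.Binary.Construct.Closure.ReflexiveTransitive using (Star)
import Relation.Binary.Construct.Add.Supremum.NonStrict as SupremumOrder
open import Relation.Binary.Core using (Rel)
open import Relation.Binary.PropositionalEquality as ≡ using (_≡_; _≢_)
open import Relation.Binary.Structures using (IsPartialOrder)
open import Relation.Nullary.Construct.Add.Supremum using (_⁺; ⊤⁺; [_])
open import Relation.Nullary.Negation.Core using (¬_)
open import Relation.Unary using (Pred)

private
  variable
    a b r c ℓ p q : Level
    n : ℕ

-- Ranks run from -1 to n; the rank j is coded by j + 1 : Fin (2 + n).
-- The order laws are not part of this record but of IsPolytope.
record RankedStructure (n : ℕ) (a b r : Level) : Set (lsuc (a ⊔ b ⊔ r)) where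
  infix 4 _≤_ _<_
  field
    faces : Setoid a b
  open Setoid faces public using (_≈_) renaming (Carrier to Face)
  field
    _≤_  : Rel Face r
    rank : Face → Fin (2 ℕ.+ n)

  _<_ : Rel Face (b ⊔ r)
  F < G = F ≤ G × ¬ (F ≈ G)

module _ (P : RankedStructure n a b r) where
  open RankedStructure P

  -- Once rank is strictly monotone, a chain has at most one face of each
  -- rank, so a chain with n + 2 faces is the same as a chain with exactly
  -- one face of each rank, and such a chain is maximal.
  record Flag : Set (a ⊔ r) where
    field
      face      : Fin (2 ℕ.+ n) → Face
      face-rank : ∀ k → rank (face k) ≡ k
      face-mono : ∀ {k l} → k Fin.≤ l → face k ≤ face l

module _ {P : RankedStructure n a b r} where
  open RankedStructure P
  open Flag

  infix 4 _≋_ _∈ᶠ_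

  _≋_ : Rel (Flag P) b
  Φ ≋ Ψ = ∀ k → face Φ k ≈ face Ψ k

  _∈ᶠ_ : Face → Flag P → Set b
  F ∈ᶠ Φ = ∃ λ k → face Φ k ≈ F

  -- IsFlip j Φ Ψ says Ψ = Φʲ.
  IsFlip : ℕ → Rel (Flag P) b
  IsFlip j Φ Ψ = ∀ k → (toℕ k ≡ suc j → ¬ (face Φ k ≈ face Ψ k))
                     × (toℕ k ≢ suc j → face Φ k ≈ face Ψ k)

  Adjacent : Rel (Flag P) b
  Adjacent Φ Ψ = ∃ λ j → j ℕ.< n × IsFlip j Φ Ψ

  ContainsMeet : Flag P → Flag P → Pred (Flag P) b
  ContainsMeet Φ Ψ Θ = ∀ k → face Φ k ≈ face Ψ k → face Φ k ≈ face Θ k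

  -- The last flag of the sequence is only required to be ≋ to Ψ, because
  -- flags are compared up to the equality of faces.
  StronglyConnected : Rel (Flag P) (a ⊔ b ⊔ r)
  StronglyConnected Φ Ψ =
    ∃ λ Ψ′ → Star (λ Θ Θ′ → Adjacent Θ Θ′ × ContainsMeet Φ Ψ Θ′) Φ Ψ′ × Ψ′ ≋ Ψ

module _ (P : RankedStructure n a b r) where
  open RankedStructure P

  Chain : Pred (List Face) (a ⊔ r)
  Chain = AllPairs (λ F G → F ≤ G ⊎ G ≤ F)

  Between : Face → Face → Pred Face (b ⊔ r)
  Between F G H = F < H × H < G

  record IsPolytope : Set (a ⊔ b ⊔ r) where
    field
      isPartialOrder : IsPartialOrder _≈_ _≤_
      rank-cong      : ∀ {F G} → F ≈ G → rank F ≡ rank G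
      rank-mono      : ∀ {F G} → F < G → rank F Fin.< rank G

      least         : Face
      least-min     : ∀ F → least ≤ F
      least-rank    : rank least ≡ Fin.zero
      greatest      : Face
      greatest-max  : ∀ F → F ≤ greatest
      greatest-rank : rank greatest ≡ fromℕ (suc n)

      -- "Every maximal chain has n + 2 faces".  Chains are finite because
      -- rank is injective on them; applied to a maximal chain C this says
      -- that C is a Flag, and conversely, if all maximal chains are Flags,
      -- extending C to a maximal chain gives the field.
      chain-in-flag : ∀ C → Chain C → ∃ λ (Φ : Flag P) → All (_∈ᶠ Φ) C

      -- A face strictly between F and G has the intermediate rank by
      -- rank-mono.
      diamond : ∀ {F G} → F < G → toℕ (rank G) ≡ 2 ℕ.+ toℕ (rank F) →
                ∃₂ λ H₁ H₂ → ¬ (H₁ ≈ H₂) × Between F G H₁ × Between F G H₂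
                           × (∀ H → Between F G H → H ≈ H₁ ⊎ H ≈ H₂)

      strongly-flag-connected : ∀ Φ Ψ → StronglyConnected {P = P} Φ Ψ

  -- Preservation of rank is automatic when P is a polytope.
  record Automorphism : Set (a ⊔ b ⊔ r) where
    field
      bijection : Inverse faces faces
    open Inverse bijection public
      using (to; from; to-cong; from-cong; strictlyInverseˡ; strictlyInverseʳ)
    field
      to-mono   : ∀ {F G} → F ≤ G → to F ≤ to G
      from-mono : ∀ {F G} → F ≤ G → from F ≤ from G
      to-rank   : ∀ F → rank (to F) ≡ rank F
      from-rank : ∀ F → rank (from F) ≡ rank F

  private
    open Automorphism
    module S = Setoid faces

    idᵃ : Automorphism
    idᵃ = record
      { bijection = record
        { to = λ F → F ; from = λ F → F
        ; to-cong = λ e → e ; from-cong = λ e → e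
        ; inverse = (λ e → e) , (λ e → e) }
      ; to-mono = λ x → x ; from-mono = λ x → x
      ; to-rank = λ _ → ≡.refl ; from-rank = λ _ → ≡.refl }

    _⨾_ : Automorphism → Automorphism → Automorphism
    α ⨾ β = record
      { bijection = record
        { to = λ F → to β (to α F) ; from = λ F → from α (from β F)
        ; to-cong = λ e → to-cong β (to-cong α e)
        ; from-cong = λ e → from-cong α (from-cong β e)
        ; inverse = (λ e → Inverse.inverseˡ (bijection β) (Inverse.inverseˡ (bijection α) e))
                  , (λ e → Inverse.inverseʳ (bijection α) (Inverse.inverseʳ (bijection β) e)) }
      ; to-mono = λ x → to-mono β (to-mono α x)
      ; from-mono = λ x → from-mono α (from-mono β x)
      ; to-rank = λ F → ≡.trans (to-rank β (to α F)) (to-rank α F)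
      ; from-rank = λ F → ≡.trans (from-rank α (from β F)) (from-rank β F) }

    invᵃ : Automorphism → Automorphism
    invᵃ α = record
      { bijection = record
        { to = from α ; from = to α
        ; to-cong = from-cong α ; from-cong = to-cong α
        ; inverse = Inverse.inverseʳ (bijection α) , Inverse.inverseˡ (bijection α) }
      ; to-mono = from-mono α ; from-mono = to-mono α
      ; to-rank = from-rank α ; from-rank = to-rank α }

    inv-cong : ∀ α β → (∀ F → to α F S.≈ to β F) → ∀ F → from α F S.≈ from β F
    inv-cong α β e F = S.trans
      (from-cong α (S.sym (S.trans (e (from β F)) (strictlyInverseˡ β F))))
      (strictlyInverseʳ α (from β F))

  -- Automorphisms act on the right: α ∙ β is "first α, then β".  This is the
  -- convention under which ρᵢ₋₁ρᵢ sends the base flag Φ to (Φⁱ)ⁱ⁻¹.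
  Γ : Group (a ⊔ b ⊔ r) (a ⊔ b)
  Γ = record
    { Carrier = Automorphism
    ; _≈_     = λ α β → ∀ F → to α F S.≈ to β F
    ; _∙_     = _⨾_
    ; ε       = idᵃ
    ; _⁻¹     = invᵃ
    ; isGroup = record
      { isMonoid = record
        { isSemigroup = record
          { isMagma = record
            { isEquivalence = record
              { refl  = λ _ → S.refl
              ; sym   = λ e F → S.sym (e F)
              ; trans = λ e f F → S.trans (e F) (f F) }
            ; ∙-cong = λ {α} {α′} {β} {β′} e f F →
                S.trans (f (to α F)) (to-cong β′ (e F)) }
          ; assoc = λ _ _ _ _ → S.refl }
        ; identity = (λ _ _ → S.refl) , (λ _ _ → S.refl) }
      ; inverse = strictlyInverseˡ , strictlyInverseʳ
      ; ⁻¹-cong = λ {α} {β} → inv-cong α β } }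

module _ {P : RankedStructure n a b r} where
  open Flag
  open Automorphism

  infixl 7 _·_

  _·_ : Flag P → Automorphism P → Flag P
  Φ · α = record
    { face      = λ k → to α (face Φ k)
    ; face-rank = λ k → ≡.trans (to-rank α (face Φ k)) (face-rank Φ k)
    ; face-mono = λ k≤l → to-mono α (face-mono Φ k≤l) }

  SameOrbit : Rel (Flag P) (a ⊔ b ⊔ r)
  SameOrbit Φ Ψ = ∃ λ α → Φ · α ≋ Ψ

module _ (G : Group c ℓ) where
  open Group G

  data ⟨_⟩ (S : Pred Carrier p) : Pred Carrier (c ⊔ ℓ ⊔ p) where
    gen  : ∀ {g} → S g → ⟨ S ⟩ g
    unit : ⟨ S ⟩ ε
    mul  : ∀ {g h} → ⟨ S ⟩ g → ⟨ S ⟩ h → ⟨ S ⟩ (g ∙ h)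
    inv  : ∀ {g} → ⟨ S ⟩ g → ⟨ S ⟩ (g ⁻¹)
    resp : ∀ {g h} → g ≈ h → ⟨ S ⟩ g → ⟨ S ⟩ h

  -- H, a subgroup, has exactly the two right cosets H and Ht.
  HasIndexTwo : Pred Carrier p → Set (c ⊔ p)
  HasIndexTwo H = ∃ λ t → ¬ H t × (∀ g → H g ⊎ H (g ∙ t ⁻¹))

  open RawMonoidDefs rawMonoid using () renaming (_×_ to _times_)

  -- Here k times g is the k-th power of g; ⊤⁺ stands for ∞.
  HasOrder : Carrier → ℕ ⁺ → Set ℓ
  HasOrder g [ k ] = 1 ℕ.≤ k × (k times g) ≈ ε
                   × (∀ j → 1 ℕ.≤ j → (j times g) ≈ ε → k ℕ.≤ j)
  HasOrder g ⊤⁺    = ∀ j → 1 ℕ.≤ j → ¬ ((j times g) ≈ ε)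

  -- Specified generators σ₁, …, σₙ₋₁ are given by a function on ℕ, of which
  -- only the values at 1, …, n - 1 are ever used.
  module _ (n : ℕ) (σ : ℕ → Carrier) where

    IsGenerator : Pred Carrier ℓ
    IsGenerator g = ∃ λ i → 1 ℕ.≤ i × i ℕ.< n × g ≈ σ i

    product : ℕ → ℕ → Carrier
    product i zero    = σ i
    product i (suc d) = product i d ∙ σ (i ℕ.+ suc d)

    -- τ i j = σᵢ ⋯ σⱼ for i ≤ j.
    τ : ℕ → ℕ → Carrier
    τ i j = product i (j ∸ i)

    IsTau : Pred ℕ q → Pred Carrier (ℓ ⊔ q)
    IsTau I g = ∃₂ λ i j → 1 ℕ.≤ i × i ℕ.≤ j × j ℕ.< n
                         × I (i ∸ 1) × I j × g ≈ τ i j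

    Sub : Pred ℕ q → Pred Carrier (c ⊔ ℓ ⊔ q)
    Sub I = ⟨ IsTau I ⟩

    -- The structure built from a group with specified generators: the faces
    -- of rank j are the right cosets of G_{N ∖ {j}}, N = {0, …, n - 1}, in
    -- ⟨σ₁, …, σₙ₋₁⟩; a face is below another if its rank is not greater and
    -- the two cosets intersect.  For j = -1 and j = n the only coset is the
    -- whole group.  For the group Γ⁺(P), n ≥ 3, this gives back P, the coset of φ
    -- corresponding to the image under φ of the j-face of the base flag.

    Stabilizer : Fin (2 ℕ.+ n) → Pred Carrier (c ⊔ ℓ)
    Stabilizer k = Sub (λ i → i ℕ.< n × suc i ≢ toℕ k)

    private
      open GroupProperties G using (⁻¹-anti-homo-∙; ⁻¹-involutive)

      CosetFace : Set (c ⊔ ℓ)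
      CosetFace = Fin (2 ℕ.+ n) × Σ Carrier ⟨ IsGenerator ⟩

      _≈ᶜ_ : Rel CosetFace (c ⊔ ℓ)
      (k , g , _) ≈ᶜ (l , h , _) = k ≡ l × Stabilizer k (g ∙ h ⁻¹)

      _≤ᶜ_ : Rel CosetFace (c ⊔ ℓ)
      (k , g , _) ≤ᶜ (l , h , _) =
        k Fin.≤ l × ∃ λ x → Stabilizer k (x ∙ g ⁻¹) × Stabilizer l (x ∙ h ⁻¹)

      swap-quotient : ∀ g h → (g ∙ h ⁻¹) ⁻¹ ≈ h ∙ g ⁻¹
      swap-quotient g h = trans (⁻¹-anti-homo-∙ g (h ⁻¹)) (∙-congʳ (⁻¹-involutive h))

      join-quotients : ∀ g h k → (g ∙ h ⁻¹) ∙ (h ∙ k ⁻¹) ≈ g ∙ k ⁻¹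
      join-quotients g h k = trans (assoc g (h ⁻¹) (h ∙ k ⁻¹)) (∙-congˡ
        (trans (sym (assoc (h ⁻¹) h (k ⁻¹)))
        (trans (∙-congʳ (inverseˡ h)) (identityˡ (k ⁻¹)))))

      cosets : Setoid (c ⊔ ℓ) (c ⊔ ℓ)
      cosets = record
        { Carrier = CosetFace
        ; _≈_ = _≈ᶜ_
        ; isEquivalence = record
          { refl  = λ {x} → ≡.refl , resp (sym (inverseʳ (proj₁ (proj₂ x)))) unit
          ; sym   = λ { {_ , g , _} {_ , h , _} (≡.refl , s) →
                        ≡.refl , resp (swap-quotient g h) (inv s) }
          ; trans = λ { {_ , g , _} {_ , h , _} {_ , k , _} (≡.refl , s) (≡.refl , t) →
                        ≡.refl , resp (join-quotients g h k) (mul s t) } } }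

    cosetStructure : RankedStructure n (c ⊔ ℓ) (c ⊔ ℓ) (c ⊔ ℓ)
    cosetStructure = record { faces = cosets ; _≤_ = _≤ᶜ_ ; rank = proj₁ }

-- IsChiral and IsDirectlyRegular below pin down σ i, for 1 ≤ i < n, as the
-- unique automorphism sending the base flag Φ to (Φⁱ)ⁱ⁻¹.
record BasedStructure (n : ℕ) (a b r : Level) : Set (lsuc (a ⊔ b ⊔ r)) where
  field
    structure : RankedStructure n a b r
    base      : Flag structure
    σ         : ℕ → Automorphism structure

module _ (P : BasedStructure n a b r) where
  open BasedStructure P
  private
    module A = Group (Γ structure)

  IsRegular : Set (a ⊔ b ⊔ r)
  IsRegular = ∀ Φ Ψ → SameOrbit {P = structure} Φ Ψ

  Γ⁺ : Pred (Automorphism structure) (a ⊔ b ⊔ r)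
  Γ⁺ = ⟨_⟩ (Γ structure) (IsGenerator (Γ structure) n σ)

  record IsDirectlyRegular : Set (a ⊔ b ⊔ r) where
    field
      isPolytope : IsPolytope structure
      isRegular  : IsRegular
      ρ          : ℕ → Automorphism structure
      ρ-base     : ∀ i → i ℕ.< n → IsFlip i base (base · ρ i)
      σ-def      : ∀ i → 1 ℕ.≤ i → i ℕ.< n → σ i A.≈ ρ (i ∸ 1) A.∙ ρ i
      index-two  : HasIndexTwo (Γ structure) Γ⁺

  record IsChiral : Set (a ⊔ b ⊔ r) where
    field
      isPolytope : IsPolytope structure
      two-orbits : ∃₂ λ (Φ₁ Φ₂ : Flag structure) → ¬ SameOrbit Φ₁ Φ₂
                     × (∀ Ψ → SameOrbit Φ₁ Ψ ⊎ SameOrbit Φ₂ Ψ)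
      adjacent   : ∀ (Φ Ψ : Flag structure) → Adjacent Φ Ψ → ¬ SameOrbit Φ Ψ
      σ-base     : ∀ i → 1 ℕ.≤ i → i ℕ.< n →
                   ∃ λ Ψ → IsFlip i base Ψ × IsFlip (i ∸ 1) Ψ (base · σ i)

  HasType : (ℕ → ℕ ⁺) → Set (a ⊔ b)
  HasType p = ∀ i → 1 ℕ.≤ i → i ℕ.< n → HasOrder (Γ structure) (σ i) (p i)

dualStructure : RankedStructure n a b r → RankedStructure n a b r
dualStructure P = record
  { faces = faces ; _≤_ = flip _≤_ ; rank = λ F → opposite (rank F) }
  where open RankedStructure P

dualAutomorphism : {P : RankedStructure n a b r} →
                   Automorphism P → Automorphism (dualStructure P)
dualAutomorphism α = record
  { bijection = bijection
  ; to-mono   = to-mono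
  ; from-mono = from-mono
  ; to-rank   = λ F → ≡.cong opposite (to-rank F)
  ; from-rank = λ F → ≡.cong opposite (from-rank F) }
  where open Automorphism α

dualFlag : {P : RankedStructure n a b r} → Flag P → Flag (dualStructure P)
dualFlag {n = n} Φ = record
  { face      = λ k → face (opposite k)
  ; face-rank = λ k → ≡.trans (≡.cong opposite (face-rank (opposite k)))
                              (opposite-involutive k)
  ; face-mono = λ k≤l → face-mono (opposite-anti k≤l) }
  where
  open Flag Φ
  opposite-anti : {k l : Fin (2 ℕ.+ n)} → k Fin.≤ l → opposite l Fin.≤ opposite k
  opposite-anti {k} {l} k≤l = ≡.subst₂ ℕ._≤_
    (≡.sym (opposite-prop l)) (≡.sym (opposite-prop k))
    (ℕₚ.∸-monoʳ-≤ (2 ℕ.+ n) (ℕ.s≤s k≤l))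

infix 9 _ᵟ

_ᵟ : BasedStructure n a b r → BasedStructure n a b r
_ᵟ {n = n} P = record
  { structure = dualStructure structure
  ; base      = dualFlag base
  ; σ         = λ i → dualAutomorphism (σ (n ∸ i)) ⁻¹ }
  where
  open BasedStructure P
  open Group (Γ (dualStructure structure)) using (_⁻¹)

infixl 8 _◇_

_◇_ : ∀ {a b r a′ b′ r′} → BasedStructure n a b r → BasedStructure n a′ b′ r′ →
      RankedStructure n (a ⊔ b ⊔ r ⊔ a′ ⊔ b′ ⊔ r′) (a ⊔ b ⊔ r ⊔ a′ ⊔ b′ ⊔ r′)
                        (a ⊔ b ⊔ r ⊔ a′ ⊔ b′ ⊔ r′)
_◇_ {n = n} P Q = cosetStructure
  (DirectProduct.group (Γ P.structure) (Γ Q.structure)) n (λ i → P.σ i , Q.σ i)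
  where
  module P = BasedStructure P
  module Q = BasedStructure Q

open SupremumOrder ℕ._≤_ public using (_≤⁺_)

-- ∞ is not relatively prime to any entry of a type, all of which are at
-- least 2.
Coprime⁺ : ℕ ⁺ → ℕ ⁺ → Set
Coprime⁺ [ k ] [ l ] = Coprime k l
Coprime⁺ [ _ ] ⊤⁺    = ⊥
Coprime⁺ ⊤⁺    _     = ⊥

{-# OPTIONS --safe #-}

-- Write β i = (σ i , σ (n ∸ i) ⁻¹).  Since the orders of σₘ₋₁ and σₘ₊₁ are
-- coprime, (σₘ₋₁ , 1) is a power of βₘ₋₁ and (σₘ₊₁ , 1) a power of βₘ₊₁.  As
-- σₘ₋₁σₘ and σₘσₘ₊₁ are involutions, x = (1 , σₘ⁻²) equals both
-- ((σₘ₋₁ , 1) βₘ)² and (βₘ (σₘ₊₁ , 1))², so the base flag Φ of the mix and its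
-- image Φx differ at most in the ranks m - 1 and m.  If the mix were strongly
-- flag-connected, flips of these two ranks would lead from Φ to Φx, whence
-- Φx = Φh or Φx = (Φh)ᵐ for a power h of βₘ.  Comparing coordinates in P, the
-- first forces σₘ² = 1; the second makes the reflection Φ ↦ Φᵐ a power of σₘ,
-- which it inverts, so again σₘ² = 1, against pₘ ≥ 3.
module Submission where

open import Defs
open import Algebra.Bundles using (Group)
import Algebra.Construct.DirectProduct as DirectProduct
import Algebra.Definitions.RawMonoid as RawMonoidDefs
open import Algebra.Morphism.Structures using (module GroupMorphisms)
import Algebra.Properties.Group as GroupProperties
import Algebra.Properties.Monoid.Mult as MonoidMult
open import Data.Empty using (⊥; ⊥-elim)
open import Data.Fin.Base as Fin using (Fin; toℕ; fromℕ<; opposite)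
open import Data.Fin.Properties using (toℕ-fromℕ<; opposite-prop; opposite-involutive)
open import Data.List.Base using ([]; _∷_)
open import Data.List.Relation.Unary.All using ([]; _∷_)
open import Data.List.Relation.Unary.AllPairs using ([]; _∷_)
open import Data.Nat.Base using (ℕ; zero; suc; _+_; _*_; _∸_; _≤_; _<_; z≤n; s≤s)
open import Data.Nat.Coprimality as Coprimality using (Coprime; coprime-Bézout)
open import Data.Nat.GCD using (module Bézout)
import Data.Nat.Properties as ℕₚ
open import Data.Product.Base using (Σ; ∃; _×_; _,_; proj₁; proj₂)
open import Data.Sum.Base using (_⊎_; inj₁; inj₂)
open import Level using (Level; _⊔_)
open import Relation.Binary.Bundles using (Setoid)
open import Relation.Binary.Construct.Closure.ReflexiveTransitive using (Star; _◅_) renaming (ε to [])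
import Relation.Binary.Construct.Add.Supremum.NonStrict as SupremumOrder
import Relation.Binary.Reasoning.Setoid as SetoidReasoning
open import Relation.Binary.PropositionalEquality as ≡ using (_≡_; _≢_)
open import Relation.Binary.Structures using (IsPartialOrder)
open import Relation.Nullary.Construct.Add.Supremum using (_⁺; ⊤⁺; [_])
open import Relation.Nullary.Decidable.Core using (Dec; yes; no)
open import Relation.Nullary.Negation.Core using (¬_)
open import Relation.Unary using (Pred)

private
  variable
    a b r c ℓ s c′ ℓ′ : Level
    n : ℕ

open Flag
open Automorphism

-- Flags and flips

module _ {P : RankedStructure n a b r} where
  open RankedStructure P
  private module S = Setoid faces

  flip-sym : ∀ {j} (Φ Ψ : Flag P) → IsFlip j Φ Ψ → IsFlip j Ψ Φ
  flip-sym _ _ f k = (λ e x → proj₁ (f k) e (S.sym x)) , (λ e → S.sym (proj₂ (f k) e))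

  flip-resp : ∀ {j} (Φ Φ′ Ψ Ψ′ : Flag P) → Φ ≋ Φ′ → Ψ ≋ Ψ′ → IsFlip j Φ Ψ → IsFlip j Φ′ Ψ′
  flip-resp _ _ _ _ p q f k =
      (λ e x → proj₁ (f k) e (S.trans (p k) (S.trans x (S.sym (q k)))))
    , (λ e → S.trans (S.sym (p k)) (S.trans (proj₂ (f k) e) (q k)))

  flip-· : ∀ {j} (Φ Ψ : Flag P) α → IsFlip j Φ Ψ → IsFlip j (Φ · α) (Ψ · α)
  flip-· _ _ α f k =
      (λ e x → proj₁ (f k) e
        (S.trans (S.sym (strictlyInverseʳ α _)) (S.trans (from-cong α x) (strictlyInverseʳ α _))))
    , (λ e → to-cong α (proj₂ (f k) e))

Neighbours : {k : ℕ} → Fin k → Fin k → Set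
Neighbours k l = suc (toℕ k) ≡ toℕ l ⊎ suc (toℕ l) ≡ toℕ k

neighbours⇒≢ : {k : ℕ} {i j : Fin k} → Neighbours i j → toℕ j ≢ toℕ i
neighbours⇒≢ (inj₁ e) e′ = ℕₚ.1+n≢n (≡.trans e e′)
neighbours⇒≢ (inj₂ e) e′ = ℕₚ.1+n≢n (≡.trans e (≡.sym e′))

module PolytopeFlips {P : RankedStructure n a b r} (isPolytope : IsPolytope P) where
  open RankedStructure P hiding (_<_; _≤_)
  open RankedStructure P using () renaming (_<_ to _≺_; _≤_ to _≼_)
  open IsPolytope isPolytope
  private module S = Setoid faces

  face-≺ : ∀ (Φ : Flag P) {k l : Fin (2 + n)} → k Fin.< l → face Φ k ≺ face Φ l
  face-≺ Φ {k} {l} k<l = face-mono Φ (ℕₚ.<⇒≤ k<l) , λ e → ℕₚ.<⇒≢ k<l (≡.cong toℕ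
    (≡.trans (≡.sym (face-rank Φ k)) (≡.trans (rank-cong e) (face-rank Φ l))))

  ≺-resp : ∀ {F F′ G G′} → F ≈ F′ → G ≈ G′ → F ≺ G → F′ ≺ G′
  ≺-resp p q (F≼G , F≉G) =
      proj₁ ≤-resp-≈ q (proj₂ ≤-resp-≈ p F≼G)
    , λ e → F≉G (S.trans p (S.trans e (S.sym q)))
    where open IsPartialOrder isPartialOrder using (≤-resp-≈)

  -- A pigeonhole argument: only two faces fit between the neighbours.
  changed-twice : ∀ (Φ Ψ Θ : Flag P) {j} (k : Fin (2 + n)) → toℕ k ≡ suc j → j < n →
    (∀ l → Neighbours k l → face Φ l ≈ face Ψ l) →
    (∀ l → Neighbours k l → face Φ l ≈ face Θ l) →
    ¬ (face Φ k ≈ face Ψ k) → ¬ (face Ψ k ≈ face Θ k) → face Φ k ≈ face Θ k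
  changed-twice Φ Ψ Θ {j} k k≡ j<n ΦΨ ΦΘ Φ≉Ψ Ψ≉Θ = conclude
    (between-all (face Φ k) (between Φ λ _ _ → S.refl))
    (between-all (face Ψ k) (between Ψ ΦΨ))
    (between-all (face Θ k) (between Θ ΦΘ))
    where
    -- Ranks are coded with a shift by one, so `lo` and `hi` have ranks `j - 1` and `j + 1`, the
    -- bounds in the diamond condition.
    lo hi : Fin (2 + n)
    lo = fromℕ< {j} (ℕₚ.m<n⇒m<1+n (ℕₚ.m<n⇒m<1+n j<n))
    hi = fromℕ< {2 + j} (s≤s (s≤s j<n))

    k-lo : suc (toℕ lo) ≡ toℕ k
    k-lo = ≡.trans (≡.cong suc (toℕ-fromℕ< _)) (≡.sym k≡)

    k-hi : suc (toℕ k) ≡ toℕ hi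
    k-hi = ≡.trans (≡.cong suc k≡) (≡.sym (toℕ-fromℕ< (s≤s (s≤s j<n))))

    lo<k : lo Fin.< k
    lo<k = ℕₚ.≤-reflexive k-lo

    k<hi : k Fin.< hi
    k<hi = ℕₚ.≤-reflexive k-hi

    rank-gap : toℕ (rank (face Φ hi)) ≡ 2 + toℕ (rank (face Φ lo))
    rank-gap = ≡.trans (≡.cong toℕ (face-rank Φ hi)) (≡.trans (≡.sym k-hi)
      (≡.trans (≡.cong suc (≡.sym k-lo))
        (≡.cong (λ x → 2 + toℕ x) (≡.sym (face-rank Φ lo)))))

    two = diamond (face-≺ Φ {lo} {hi} (ℕₚ.<-trans lo<k k<hi)) rank-gap
    H₁ H₂ : Face
    H₁ = proj₁ two
    H₂ = proj₁ (proj₂ two)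
    between-all : ∀ H → Between P (face Φ lo) (face Φ hi) H → H ≈ H₁ ⊎ H ≈ H₂
    between-all = proj₂ (proj₂ (proj₂ (proj₂ (proj₂ two))))

    between : ∀ (Ξ : Flag P) → (∀ l → Neighbours k l → face Φ l ≈ face Ξ l) →
              Between P (face Φ lo) (face Φ hi) (face Ξ k)
    between Ξ e = ≺-resp (S.sym (e lo (inj₂ k-lo))) S.refl (face-≺ Ξ lo<k)
                , ≺-resp S.refl (S.sym (e hi (inj₁ k-hi))) (face-≺ Ξ k<hi)

    conclude : face Φ k ≈ H₁ ⊎ face Φ k ≈ H₂ → face Ψ k ≈ H₁ ⊎ face Ψ k ≈ H₂ →
               face Θ k ≈ H₁ ⊎ face Θ k ≈ H₂ → face Φ k ≈ face Θ k
    conclude (inj₁ p) (inj₁ q) _        = ⊥-elim (Φ≉Ψ (S.trans p (S.sym q)))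
    conclude (inj₂ p) (inj₂ q) _        = ⊥-elim (Φ≉Ψ (S.trans p (S.sym q)))
    conclude _        (inj₁ p) (inj₁ q) = ⊥-elim (Ψ≉Θ (S.trans p (S.sym q)))
    conclude _        (inj₂ p) (inj₂ q) = ⊥-elim (Ψ≉Θ (S.trans p (S.sym q)))
    conclude (inj₁ p) (inj₂ _) (inj₁ q) = S.trans p (S.sym q)
    conclude (inj₂ p) (inj₁ _) (inj₂ q) = S.trans p (S.sym q)

  -- At rank `j` the passage from `Ψ` through `Φ` to `Θ` changes the face twice, and the diamond
  -- condition leaves only two candidates.
  flip-unique : ∀ {j} → j < n → (Φ Ψ Θ : Flag P) → IsFlip j Φ Ψ → IsFlip j Φ Θ → Ψ ≋ Θ
  flip-unique {j} j<n Φ Ψ Θ f g k with toℕ k ℕₚ.≟ suc j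
  ... | no k≢  = S.trans (S.sym (proj₂ (f k) k≢)) (proj₂ (g k) k≢)
  ... | yes k≡ = changed-twice Ψ Φ Θ k k≡ j<n
    (λ l nb → S.sym (proj₂ (f l) (off l nb)))
    (λ l nb → S.trans (S.sym (proj₂ (f l) (off l nb))) (proj₂ (g l) (off l nb)))
    (λ e → proj₁ (f k) k≡ (S.sym e)) (proj₁ (g k) k≡)
    where
    off : ∀ l → Neighbours k l → toℕ l ≢ suc j
    off l nb e = neighbours⇒≢ nb (≡.trans e (≡.sym k≡))

  -- By `flip-unique`, an automorphism fixing a flag fixes each adjacent flag. Every face lies in
  -- some flag, and connectedness reaches that flag from `Φ`.
  rigid : ∀ (Φ : Flag P) α → Φ · α ≋ Φ → ∀ F → to α F ≈ F
  rigid Φ α fixed F with chain-in-flag (F ∷ []) ([] ∷ [])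
  ... | Ψ , (k , Ψk≈F) ∷ [] with strongly-flag-connected Φ Ψ
  ...   | Ψ′ , path , Ψ′≋Ψ = S.trans (to-cong α (S.sym F≈)) (S.trans (walk path fixed k) F≈)
    where
    F≈ : face Ψ′ k ≈ F
    F≈ = S.trans (Ψ′≋Ψ k) Ψk≈F

    walk : ∀ {Θ Ξ} → Star (λ Θ Θ′ → Adjacent Θ Θ′ × ContainsMeet Φ Ψ Θ′) Θ Ξ →
           Θ · α ≋ Θ → Ξ · α ≋ Ξ
    walk [] e = e
    walk {Θ} (_◅_ {j = Θ′} ((j , j<n , f) , _) path) e = walk path
      (flip-unique j<n Θ (Θ′ · α) Θ′
        (flip-resp (Θ · α) Θ (Θ′ · α) (Θ′ · α) e (λ _ → S.refl) (flip-· Θ Θ′ α f)) f)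

  -- The ranks next to `2 + i` are untouched by all three flips, so the second change at `2 + i`
  -- undoes the first and only the change at `i` remains.
  flip-square : ∀ {i} → 2 + i < n → (Φ Ψ Θ Ξ : Flag P) →
    IsFlip (2 + i) Φ Ψ → IsFlip i Ψ Θ → IsFlip (2 + i) Θ Ξ → IsFlip i Φ Ξ
  flip-square {i} i<n Φ Ψ Θ Ξ f g h k = changed , unchanged
    where
    changed : toℕ k ≡ suc i → ¬ (face Φ k ≈ face Ξ k)
    changed k≡ e = proj₁ (g k) k≡
      (S.trans (S.sym (proj₂ (f k) k≢)) (S.trans e (S.sym (proj₂ (h k) k≢))))
      where
      k≢ : toℕ k ≢ 3 + i
      k≢ e = ℕₚ.m≢1+n+m (suc i) {1} (≡.trans (≡.sym k≡) e)

    off : toℕ k ≡ 3 + i → ∀ l → Neighbours k l → toℕ l ≢ suc i × toℕ l ≢ 3 + i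
    off k≡ l nb = (not-i nb , λ e → neighbours⇒≢ nb (≡.trans e (≡.sym k≡)))
      where
      not-i : Neighbours k l → toℕ l ≢ suc i
      not-i (inj₁ p) q = ℕₚ.m≢1+n+m (suc i) {2} (≡.trans (≡.sym q) (≡.trans (≡.sym p) (≡.cong suc k≡)))
      not-i (inj₂ p) q = ℕₚ.m≢1+n+m (suc i) {0} (≡.trans (≡.sym q) (ℕₚ.suc-injective (≡.trans p k≡)))

    unchanged : toℕ k ≢ suc i → face Φ k ≈ face Ξ k
    unchanged k≢ with toℕ k ℕₚ.≟ 3 + i
    ... | no k≢′ = S.trans (proj₂ (f k) k≢′) (S.trans (proj₂ (g k) k≢) (proj₂ (h k) k≢′))
    ... | yes k≡ = changed-twice Φ Ψ Ξ k k≡ i<n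
      (λ l nb → proj₂ (f l) (proj₂ (off k≡ l nb)))
      (λ l nb → S.trans (proj₂ (f l) (proj₂ (off k≡ l nb)))
        (S.trans (proj₂ (g l) (proj₁ (off k≡ l nb))) (proj₂ (h l) (proj₂ (off k≡ l nb)))))
      (proj₁ (f k) k≡)
      (λ e → proj₁ (h k) k≡ (S.trans (S.sym (proj₂ (g k) k≢)) e))

-- Rotations of the base flag

-- α sends Φ to (Φⁱ)ʲ.
IsRotation : {P : RankedStructure n a b r} → Flag P → ℕ → ℕ → Automorphism P → Set (a ⊔ b ⊔ r)
IsRotation Φ i j α = ∃ λ Ψ → IsFlip i Φ Ψ × IsFlip j Ψ (Φ · α)

module Rotations {P : RankedStructure n a b r} (isPolytope : IsPolytope P) (Φ : Flag P) where
  open RankedStructure P hiding (_<_; _≤_)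
  open PolytopeFlips isPolytope
  private
    module S = Setoid faces
    module A = Group (Γ P)

  rotation-resp : ∀ {i j} α β → α A.≈ β → IsRotation Φ i j α → IsRotation Φ i j β
  rotation-resp α β e (Ψ , f , g) =
    Ψ , f , flip-resp Ψ Ψ (Φ · α) (Φ · β) (λ _ → S.refl) (λ k → e (face Φ k)) g

  -- Φαβ = (Φβ)ʲⁱ = Φᵏʲʲⁱ, since flips commute with automorphisms.
  rotation-∙ : ∀ {i j k} α β → j < n →
    IsRotation Φ j i α → IsRotation Φ k j β → IsRotation Φ k i (α A.∙ β)
  rotation-∙ α β j<n (Ψ , f , g) (Ξ , f′ , g′) =
    Ξ , f′ , flip-resp (Ψ · β) Ξ (Φ · α · β) (Φ · (α A.∙ β)) Ψβ≋Ξ (λ _ → S.refl)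
               (flip-· Ψ (Φ · α) β g)
    where
    Ψβ≋Ξ : Ψ · β ≋ Ξ
    Ψβ≋Ξ = flip-unique j<n (Φ · β) (Ψ · β) Ξ (flip-· Φ Ψ β f) (flip-sym Ξ (Φ · β) g′)

  -- Applying `α⁻¹` to the flips from `Φ` through `Ψ` to `Φα` gives flips from `Φα⁻¹` to `Φ`, which
  -- are then read backwards.
  rotation-⁻¹ : ∀ {i j} α → IsRotation Φ i j α → IsRotation Φ j i (α A.⁻¹)
  rotation-⁻¹ α (Ψ , f , g) =
      Ψ · α A.⁻¹
    , flip-sym (Ψ · α A.⁻¹) Φ (flip-resp (Ψ · α A.⁻¹) (Ψ · α A.⁻¹) (Φ · α · α A.⁻¹) Φ
        (λ _ → S.refl) (λ k → strictlyInverseʳ α (face Φ k)) (flip-· Ψ (Φ · α) (α A.⁻¹) g))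
    , flip-sym (Φ · α A.⁻¹) (Ψ · α A.⁻¹) (flip-· Φ Ψ (α A.⁻¹) f)

  rotation-fixes : ∀ {i j} α → IsRotation Φ i j α →
    ∀ k → toℕ k ≢ suc i → toℕ k ≢ suc j → to α (face Φ k) ≈ face Φ k
  rotation-fixes α (Ψ , f , g) k k≢i k≢j =
    S.sym (S.trans (proj₂ (f k) k≢i) (proj₂ (g k) k≢j))

  rotation-moves-first : ∀ {i j} α → i ≢ j → IsRotation Φ i j α →
    ∀ k → toℕ k ≡ suc i → ¬ (to α (face Φ k) ≈ face Φ k)
  rotation-moves-first α i≢j (Ψ , f , g) k k≡ e = proj₁ (f k) k≡ (S.trans (S.sym e)
    (S.sym (proj₂ (g k) λ k≡j → i≢j (ℕₚ.suc-injective (≡.trans (≡.sym k≡) k≡j)))))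

  rotation-moves-second : ∀ {i j} α → i ≢ j → IsRotation Φ i j α →
    ∀ k → toℕ k ≡ suc j → ¬ (to α (face Φ k) ≈ face Φ k)
  rotation-moves-second α i≢j (Ψ , f , g) k k≡ e = proj₁ (g k) k≡ (S.trans (S.sym
    (proj₂ (f k) λ k≡i → i≢j (ℕₚ.suc-injective (≡.trans (≡.sym k≡i) k≡)))) (S.sym e))

  -- The flips along `Φ`, `Ψ`, `Φα`, `Ψα` have ranks `2 + i`, `i`, `2 + i`, so `flip-square` makes
  -- `Ψα` the `i`-flip of `Φ`. The `i`-flip of `Ψα` is also `Φα²`, hence `Φα² = Φ`.
  half-turn : ∀ {i} α → 2 + i < n → IsRotation Φ (2 + i) i α → α A.∙ α A.≈ A.ε
  half-turn α i<n (Ψ , f , g) = rigid Φ (α A.∙ α)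
    (flip-unique (ℕₚ.<-trans (ℕₚ.n<1+n _) (ℕₚ.<-trans (ℕₚ.n<1+n _) i<n))
      (Ψ · α) (Φ · (α A.∙ α)) Φ
      (flip-· Ψ (Φ · α) α g)
      (flip-sym Φ (Ψ · α) (flip-square i<n Φ Ψ (Φ · α) (Ψ · α) f g (flip-· Φ Ψ α f))))

  -- The hypotheses say that γ is the reflection sending Φ to Φⁱ; it inverts
  -- the rotation α, and also commutes with it.
  commuting-reflection : ∀ {i j} α γ → i ≢ j → i < n → j < n → IsRotation Φ i j α →
    α A.∙ γ A.≈ γ A.∙ α →
    (∀ k → toℕ k ≢ suc i → to γ (face Φ k) ≈ face Φ k) →
    (∀ k → toℕ k ≡ suc i → to (α A.∙ γ) (face Φ k) ≈ face Φ k) →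
    α A.∙ α A.≈ A.ε
  commuting-reflection {i} {j} α γ i≢j i<n j<n (Ψ , f , g) comm fixes moves =
    -- `γ` carries the `j`-flip from `Ψ` to `Φα` to one from `Φ` to `Φαγ = Φγα = Ψα`. As `Φα²` is
    -- the `j`-flip of `Ψα`, it equals `Φ`.
    rigid Φ (α A.∙ α) (flip-unique j<n (Ψ · α) (Φ · (α A.∙ α)) Φ (flip-· Ψ (Φ · α) α g)
      (flip-sym Φ (Ψ · α) (flip-resp (Ψ · γ) Φ (Φ · α · γ) (Ψ · α) Ψγ≋Φ
        (λ k → S.trans (comm (face Φ k)) (to-cong α (Φγ≋Ψ k)))
        (flip-· Ψ (Φ · α) γ g))))
    where
    Ψγ≋Φ : Ψ · γ ≋ Φ
    Ψγ≋Φ k with toℕ k ℕₚ.≟ suc i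
    ... | no k≢  = S.trans (to-cong γ (S.sym (proj₂ (f k) k≢))) (fixes k k≢)
    ... | yes k≡ = S.trans (to-cong γ (proj₂ (g k)
      λ k≡j → i≢j (ℕₚ.suc-injective (≡.trans (≡.sym k≡) k≡j)))) (moves k k≡)

    Φγ≋Ψ : Φ · γ ≋ Ψ
    Φγ≋Ψ = flip-unique i<n Φ (Φ · γ) Ψ (flip-sym (Φ · γ) Φ
      (flip-resp (Φ · γ) (Φ · γ) (Ψ · γ) Φ (λ _ → S.refl) Ψγ≋Φ (flip-· Φ Ψ γ f))) f

-- Stabilizers in a group acting on a polytope

-- `label` translates ranks of the coset structure into ranks of `P`, so that one argument serves
-- both coordinates of the mix: it is the identity for the first and order reversal for the second.
module Action {P : RankedStructure n a b r} (isPolytope : IsPolytope P) (Φ : Flag P)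
  (G : Group c ℓ) (act : Group.Carrier G → Automorphism P)
  (act-homo : GroupMorphisms.IsGroupHomomorphism (Group.rawGroup G) (Group.rawGroup (Γ P)) act)
  (σ : ℕ → Group.Carrier G) (label : ℕ → ℕ) (label<n : ∀ {i} → i < n → label i < n)
  (σ-rotation : ∀ i → 1 ≤ i → i < n → IsRotation Φ (label i) (label (i ∸ 1)) (act (σ i)))
  where
  open RankedStructure P hiding (_<_; _≤_)
  open Rotations isPolytope Φ
  open GroupMorphisms.IsGroupHomomorphism act-homo
  private
    module S = Setoid faces
    module A = Group (Γ P)
    module G = Group G

  -- By `rotation-∙` the inner flips of consecutive factors cancel, which leaves one flip from each
  -- end of the product.
  product-rotation : ∀ i d → 1 ≤ i → i + d < n →
    IsRotation Φ (label (i + d)) (label (i ∸ 1)) (act (product G n σ i d))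
  product-rotation i zero 1≤i i<n rewrite ℕₚ.+-identityʳ i = σ-rotation i 1≤i i<n
  product-rotation i (suc d) 1≤i i<n rewrite ℕₚ.+-suc i d =
    rotation-resp (α A.∙ β) (act (product G n σ i d G.∙ σ (suc (i + d))))
      (A.sym {act (product G n σ i d G.∙ σ (suc (i + d)))} {α A.∙ β} (homo _ _))
      (rotation-∙ α β (label<n i+d<n)
      (product-rotation i d 1≤i i+d<n) (σ-rotation (suc (i + d)) (s≤s z≤n) i<n))
    where
    α β : Automorphism P
    α = act (product G n σ i d)
    β = act (σ (suc (i + d)))
    i+d<n : i + d < n
    i+d<n = ℕₚ.<-trans (ℕₚ.n<1+n _) i<n

  -- The condition says that only the rank coded by `k` can translate to the rank coded by `l`. A
  -- generator `τ i j` of the stabilizer avoids `k` at both ends, so by `product-rotation` it does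
  -- not touch the face at `l`.
  stabilizer-fixes : ∀ k l → (∀ j → j < n → toℕ l ≡ suc (label j) → suc j ≡ toℕ k) →
    ∀ {g} → Stabilizer G n σ k g → to (act g) (face Φ l) ≈ face Φ l
  stabilizer-fixes k l kl (gen (i , j , 1≤i , i≤j , j<n , (i-1<n , i≢) , (_ , j≢) , g≈)) =
    S.trans (⟦⟧-cong g≈ (face Φ l)) (rotation-fixes (act (τ G n σ i j))
      (≡.subst (λ x → IsRotation Φ (label x) (label (i ∸ 1)) (act (τ G n σ i j))) i+d≡j
        (product-rotation i (j ∸ i) 1≤i (≡.subst (_< n) (≡.sym i+d≡j) j<n)))
      l (λ e → j≢ (kl j j<n e)) (λ e → i≢ (kl (i ∸ 1) i-1<n e)))
    where
    i+d≡j : i + (j ∸ i) ≡ j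
    i+d≡j = ℕₚ.m+[n∸m]≡n i≤j
  stabilizer-fixes k l kl unit = ε-homo (face Φ l)
  stabilizer-fixes k l kl (mul {g} {h} s t) = S.trans (homo g h (face Φ l))
    (S.trans (to-cong (act h) (stabilizer-fixes k l kl s)) (stabilizer-fixes k l kl t))
  stabilizer-fixes k l kl (inv {g} s) = S.trans (⁻¹-homo g (face Φ l))
    (S.trans (from-cong (act g) (S.sym (stabilizer-fixes k l kl s))) (strictlyInverseʳ (act g) _))
  stabilizer-fixes k l kl (resp g≈h s) =
    S.trans (S.sym (⟦⟧-cong g≈h (face Φ l))) (stabilizer-fixes k l kl s)

-- Powers and generated subgroups

module Powers (G : Group c ℓ) where
  open Group G
  open GroupProperties G using (ε⁻¹≈ε; ⁻¹-anti-homo-∙)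
  open MonoidMult monoid public using (×-homo-+; ×-homo-1; ×-congˡ) renaming (_×_ to infixr 8 _times_)
  open SetoidReasoning setoid

  times-multiple : ∀ {g} k q → q times g ≈ ε → (k * q) times g ≈ ε
  times-multiple zero q e = refl
  times-multiple {g} (suc k) q e = begin
    (q + k * q) times g               ≈⟨ ×-homo-+ g q (k * q) ⟩
    (q times g) ∙ ((k * q) times g)   ≈⟨ ∙-cong e (times-multiple k q e) ⟩
    ε ∙ ε                             ≈⟨ identityˡ ε ⟩
    ε                                 ∎

  times-⁻¹ : ∀ g k → k times (g ⁻¹) ≈ (k times g) ⁻¹
  times-⁻¹ g zero    = sym ε⁻¹≈ε
  times-⁻¹ g (suc k) = begin
    g ⁻¹ ∙ k times (g ⁻¹)      ≈⟨ ∙-congˡ (times-⁻¹ g k) ⟩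
    g ⁻¹ ∙ (k times g) ⁻¹      ≈⟨ ⁻¹-anti-homo-∙ (k times g) g ⟨
    ((k times g) ∙ g) ⁻¹       ≈⟨ ⁻¹-cong (∙-congˡ (×-homo-1 g)) ⟨
    (k times g ∙ 1 times g) ⁻¹ ≈⟨ ⁻¹-cong (×-homo-+ g k 1) ⟨
    ((k + 1) times g) ⁻¹       ≈⟨ ⁻¹-cong (×-congˡ {g} (ℕₚ.+-comm k 1)) ⟩
    (suc k times g) ⁻¹         ∎

  times-closed : ∀ {S : Pred Carrier s} {g} k → ⟨_⟩ G S g → ⟨_⟩ G S (k times g)
  times-closed zero    _ = unit
  times-closed (suc k) m = mul m (times-closed k m)

module _ (G : Group c ℓ) (H : Group c′ ℓ′) where
  private
    module G = Group G
    module H = Group H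
    module Gᵖ = Powers G
    module Hᵖ = Powers H
    GH = DirectProduct.group G H
    module GH = Group GH
    module GHᵖ = Powers GH

  proj₁-times : ∀ k g → proj₁ (k GHᵖ.times g) ≡ k Gᵖ.times proj₁ g
  proj₁-times zero    g = ≡.refl
  proj₁-times (suc k) g = ≡.cong (proj₁ g G.∙_) (proj₁-times k g)

  proj₂-times : ∀ k g → proj₂ (k GHᵖ.times g) ≡ k Hᵖ.times proj₂ g
  proj₂-times zero    g = ≡.refl
  proj₂-times (suc k) g = ≡.cong (proj₂ g H.∙_) (proj₂-times k g)

  -- Bézout gives a multiple of `q` that is `1` modulo `p`, or a multiple of `p` that is `1` modulo
  -- `q`. That power of `(u , v)` is `(u , ε)` in the first case; in the second it is `(ε , v)`,
  -- which is divided out.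
  coprime-split : ∀ {S : Pred GH.Carrier s} {u v p q} → Coprime p q →
    p Gᵖ.times u G.≈ G.ε → q Hᵖ.times v H.≈ H.ε →
    ⟨_⟩ GH S (u , v) → ⟨_⟩ GH S (u , H.ε)
  coprime-split {u = u} {v} {p} {q} cop up vq uv with coprime-Bézout cop
  ... | Bézout.-+ x y eq = resp
    ( G.trans (G.reflexive (proj₁-times (y * q) (u , v)))
        (G.trans (G.reflexive (≡.cong (Gᵖ._times u) (≡.sym eq)))
          (G.trans (G.∙-congˡ (Gᵖ.times-multiple x p up)) (G.identityʳ u)))
    , H.trans (H.reflexive (proj₂-times (y * q) (u , v))) (Hᵖ.times-multiple y q vq))
    (GHᵖ.times-closed (y * q) uv)
  ... | Bézout.+- x y eq = resp
    ( G.trans (G.∙-congˡ (G.trans (G.⁻¹-cong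
        (G.trans (G.reflexive (proj₁-times (x * p) (u , v))) (Gᵖ.times-multiple x p up)))
        (GroupProperties.ε⁻¹≈ε G))) (G.identityʳ u)
    , H.trans (H.∙-congˡ (H.⁻¹-cong (H.trans (H.reflexive (proj₂-times (x * p) (u , v)))
        (H.trans (H.reflexive (≡.cong (Hᵖ._times v) (≡.sym eq)))
          (H.trans (H.∙-congˡ (Hᵖ.times-multiple y q vq)) (H.identityʳ v))))))
        (H.inverseʳ v))
    (mul uv (inv (GHᵖ.times-closed (x * p) uv)))

module _ (G : Group c ℓ) (n : ℕ) (σ : ℕ → Group.Carrier G) where
  open Group G

  τ-single : ∀ i → τ G n σ i i ≡ σ i
  τ-single i rewrite ℕₚ.n∸n≡0 i = ≡.refl

  τ-pair : ∀ i → τ G n σ i (suc i) ≡ σ i ∙ σ (suc i)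
  τ-pair i rewrite ℕₚ.m+n∸n≡m 1 i | ℕₚ.+-comm i 1 = ≡.refl

  generator∈stabilizer : ∀ i k → suc i < n → toℕ k ≢ suc i → toℕ k ≢ 2 + i →
    Stabilizer G n σ k (σ (suc i))
  generator∈stabilizer i k i<n k≢ k≢′ = gen (suc i , suc i , s≤s z≤n , ℕₚ.≤-refl , i<n
    , (ℕₚ.<-trans (ℕₚ.n<1+n i) i<n , λ e → k≢ (≡.sym e)) , (i<n , λ e → k≢′ (≡.sym e))
    , reflexive (≡.sym (τ-single (suc i))))

-- Flags of the coset structure that agree with the base flag outside the ranks
-- m - 1 and m, where m = 2 + l

module CosetPolygon (G : Group c ℓ) (n : ℕ) (σ : ℕ → Group.Carrier G) (l : ℕ) (m<n : 2 + l < n)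
  -- The codes `2 + l` and `3 + l` stand for the ranks `m - 1` and `m`. The two hypotheses ensure
  -- that the flips below really change a face.
  (moves-m-1 : ∀ k → toℕ k ≡ 2 + l → ¬ Stabilizer G n σ k (σ (2 + l)))
  (moves-m   : ∀ k → toℕ k ≡ 3 + l → ¬ Stabilizer G n σ k (σ (2 + l)))
  where
  open Group G
  open GroupProperties G

  private
    m : ℕ
    m = 2 + l

    m-1<n : suc l < n
    m-1<n = ℕₚ.<-trans (ℕₚ.n<1+n _) m<n

    M : RankedStructure n (c ⊔ ℓ) (c ⊔ ℓ) (c ⊔ ℓ)
    M = cosetStructure G n σ

    module M = Setoid (RankedStructure.faces M)

  Element : Set (c ⊔ ℓ)
  Element = Σ Carrier (⟨_⟩ G (IsGenerator G n σ))

  -- Since the action is on the right, multiplying by `σ m` on the left moves `Φh` to `Φσₘh`, two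
  -- flips further round the polygon.
  forward backward : Element → Element
  forward  (h , h∈) = σ m ∙ h , mul (gen (m , s≤s z≤n , m<n , refl)) h∈
  backward (h , h∈) = σ m ⁻¹ ∙ h , mul (inv (gen (m , s≤s z≤n , m<n , refl))) h∈

  trivial-quotient : ∀ k h → Stabilizer G n σ k (h ∙ h ⁻¹)
  trivial-quotient k h = resp (sym (inverseʳ h)) unit

  σm∈stabilizer : ∀ k → toℕ k ≢ m → toℕ k ≢ suc m → Stabilizer G n σ k (σ m)
  σm∈stabilizer k = generator∈stabilizer G n σ (suc l) k m<n

  -- The image Φh of the base flag Φ.
  even : Element → Flag M
  even h = record
    { face      = λ k → k , h
    ; face-rank = λ _ → ≡.refl
    ; face-mono = λ {k} {k′} k≤k′ →
        k≤k′ , proj₁ h , trivial-quotient k (proj₁ h) , trivial-quotient k′ (proj₁ h) }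

  choose : ∀ {q} {Q : Set q} → Dec Q → Element → Element
  choose (yes _) h = forward h
  choose (no  _) h = h

  Meet : Fin (2 + n) → Fin (2 + n) → Carrier → Carrier → Set (c ⊔ ℓ)
  Meet k k′ g h = ∃ λ y → Stabilizer G n σ k (y ∙ g ⁻¹) × Stabilizer G n σ k′ (y ∙ h ⁻¹)

  -- The m-face of Φσₘ meets the (m - 1)-face of Φ in σₘ₋₁σₘ.
  forward-meets : ∀ k k′ → toℕ k ≢ suc m → toℕ k′ ≡ suc m → ∀ h → Meet k k′ h (σ m ∙ h)
  forward-meets k k′ k≢ k′≡ h with toℕ k ℕₚ.≟ m
  ... | no k≢m = σ m ∙ h
    , resp (sym (//-rightDividesʳ h (σ m))) (σm∈stabilizer k k≢m k≢)
    , trivial-quotient k′ (σ m ∙ h)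
  ... | yes k≡m = σ (suc l) ∙ (σ m ∙ h)
    , resp (sym (trans (∙-congʳ (sym (assoc (σ (suc l)) (σ m) h)))
        (//-rightDividesʳ h (σ (suc l) ∙ σ m))))
        (gen (suc l , m , s≤s z≤n , ℕₚ.n≤1+n _ , m<n
          , (ℕₚ.<-trans (ℕₚ.n<1+n _) m-1<n , λ e → ℕₚ.1+n≢n (≡.sym (≡.trans e k≡m)))
          , (m<n , λ e → k≢ (≡.sym e))
          , reflexive (≡.sym (τ-pair G n σ (suc l)))))
    , resp (sym (//-rightDividesʳ (σ m ∙ h) (σ (suc l))))
        (generator∈stabilizer G n σ l k′ m-1<n
          (λ e → ℕₚ.m≢1+n+m (suc l) {1} (≡.trans (≡.sym e) k′≡))
          (λ e → ℕₚ.1+n≢n (≡.trans (≡.sym k′≡) e)))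

  -- The flag (Φh)ᵐ.
  odd : Element → Flag M
  odd h = record
    { face      = λ k → k , choose (toℕ k ℕₚ.≟ suc m) h
    ; face-rank = λ _ → ≡.refl
    ; face-mono = λ {k} {k′} k≤k′ → k≤k′ , meets k k′ (toℕ k ℕₚ.≟ suc m) (toℕ k′ ℕₚ.≟ suc m) }
    where
    meets : ∀ k k′ (d : Dec (toℕ k ≡ suc m)) (d′ : Dec (toℕ k′ ≡ suc m)) →
      Meet k k′ (proj₁ (choose d h)) (proj₁ (choose d′ h))
    meets k k′ (yes _) (yes _) =
      σ m ∙ proj₁ h , trivial-quotient k (σ m ∙ proj₁ h) , trivial-quotient k′ (σ m ∙ proj₁ h)
    meets k k′ (no _)  (no _)  =
      proj₁ h , trivial-quotient k (proj₁ h) , trivial-quotient k′ (proj₁ h)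
    meets k k′ (no p)  (yes q) = forward-meets k k′ p q (proj₁ h)
    meets k k′ (yes p) (no q)  with forward-meets k′ k q p (proj₁ h)
    ... | y , s , t = y , t , s

  flip-even-m : ∀ h → IsFlip m (even h) (odd h)
  flip-even-m h@(g , _) k with toℕ k ℕₚ.≟ suc m
  ... | no k≢  = (λ e _ → k≢ e) , (λ _ → ≡.refl , trivial-quotient k g)
  ... | yes k≡ = (λ _ e → moves-m k k≡
      (resp (//-rightDividesʳ g (σ m)) (proj₂ (M.sym {k , h} {k , forward h} e))))
    , (λ k≢ → ⊥-elim (k≢ k≡))

  -- `(Φh)ᵐ` already has the `m`-face of `Φσₘh`. At ranks other than `m - 1` and `m`, `σ m`
  -- stabilizes the base faces, so only rank `m - 1` can differ.
  flip-odd-m-1 : ∀ h → IsFlip (suc l) (odd h) (even (forward h))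
  flip-odd-m-1 h@(g , _) k with toℕ k ℕₚ.≟ suc m
  ... | yes k≡ = (λ e → ⊥-elim (ℕₚ.1+n≢n (≡.trans (≡.sym k≡) e)))
    , (λ _ → ≡.refl , trivial-quotient k (σ m ∙ g))
  ... | no k≢ = (λ k≡ e → moves-m-1 k k≡
      (resp (//-rightDividesʳ g (σ m)) (proj₂ (M.sym {k , h} {k , forward h} e))))
    , (λ k≢m → M.sym {k , forward h} {k , h} (≡.refl
        , resp (sym (//-rightDividesʳ g (σ m))) (σm∈stabilizer k k≢m k≢)))

  flip-even-m-1 : ∀ h → IsFlip (suc l) (even h) (odd (backward h))
  flip-even-m-1 h@(g , _) = flip-sym (odd (backward h)) (even h)
    (flip-resp (odd (backward h)) (odd (backward h)) (even (forward (backward h))) (even h)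
      (λ k → M.refl {face (odd (backward h)) k})
      (λ k → ≡.refl , resp (sym (x≈y⇒x∙y⁻¹≈ε (\\-leftDividesˡ (σ m) g))) unit)
      (flip-odd-m-1 (backward h)))

  -- The constructors follow a walk along the polygon: each `(m - 1)`-flip multiplies on the left by
  -- `σ m` or its inverse.
  data Power : Pred Carrier c where
    one   : Power ε
    times : ∀ {h} → Power h → Power (σ m ∙ h)
    over  : ∀ {h} → Power h → Power (σ m ⁻¹ ∙ h)

  OnPolygon : Flag M → Set (c ⊔ ℓ)
  OnPolygon Θ = ∃ λ h → Power (proj₁ h) × (Θ ≋ even h ⊎ Θ ≋ odd h)

  module _ (isPolytope : IsPolytope M) where
    open PolytopeFlips isPolytope

    flip-matches : ∀ {j} → j < n → ∀ Θ Θ′ A B →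
      Θ ≋ A → IsFlip j A B → IsFlip j Θ Θ′ → Θ′ ≋ B
    flip-matches j<n Θ Θ′ A B e f g = flip-unique j<n Θ Θ′ B g (flip-resp A Θ B B
      (λ k → M.sym {face Θ k} {face A k} (e k)) (λ k → M.refl {face B k}) f)

    -- Flips are unique in a polytope, so at a flag of the polygon the explicit flips above are the
    -- only ones of ranks `m` and `m - 1`, and they stay on it.
    onPolygon-flip : ∀ {j} Θ Θ′ → j ≡ m ⊎ j ≡ suc l → IsFlip j Θ Θ′ → OnPolygon Θ → OnPolygon Θ′
    onPolygon-flip Θ Θ′ (inj₁ ≡.refl) f (h , p , inj₁ e) =
      h , p , inj₂ (flip-matches m<n Θ Θ′ (even h) (odd h) e (flip-even-m h) f)
    onPolygon-flip Θ Θ′ (inj₁ ≡.refl) f (h , p , inj₂ e) =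
      h , p , inj₁ (flip-matches m<n Θ Θ′ (odd h) (even h) e
        (flip-sym (even h) (odd h) (flip-even-m h)) f)
    onPolygon-flip Θ Θ′ (inj₂ ≡.refl) f (h , p , inj₁ e) =
      backward h , over p , inj₂ (flip-matches m-1<n Θ Θ′ (even h) (odd (backward h)) e
        (flip-even-m-1 h) f)
    onPolygon-flip Θ Θ′ (inj₂ ≡.refl) f (h , p , inj₂ e) =
      forward h , times p , inj₁ (flip-matches m-1<n Θ Θ′ (odd h) (even (forward h)) e
        (flip-odd-m-1 h) f)

    module _ (x : Element)
      (x-stable : ∀ k → toℕ k ≢ m → toℕ k ≢ suc m → Stabilizer G n σ k (proj₁ x)) where

      private
        Φ Φx : Flag M
        Φ  = even (ε , unit)
        Φx = even x

        agree : ∀ k → toℕ k ≢ m → toℕ k ≢ suc m → M._≈_ (face Φ k) (face Φx k)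
        agree k k≢m k≢m+1 = ≡.refl , resp (sym (identityˡ _)) (inv (x-stable k k≢m k≢m+1))

        -- Both flags contain every face shared by `Φ` and `Φx`, so they agree at all ranks except
        -- possibly `m - 1` and `m`.
        flip-rank : ∀ {j} → j < n → ∀ Θ Θ′ → ContainsMeet Φ Φx Θ → ContainsMeet Φ Φx Θ′ →
          IsFlip j Θ Θ′ → j ≡ m ⊎ j ≡ suc l
        flip-rank {j} j<n Θ Θ′ c c′ f with j ℕₚ.≟ m | j ℕₚ.≟ suc l
        ... | yes e | _     = inj₁ e
        ... | no _  | yes e = inj₂ e
        ... | no j≢ | no j≢′ = ⊥-elim (proj₁ (f k) k≡
          (M.trans {face Θ k} {face Φ k} {face Θ′ k}
            (M.sym {face Φ k} {face Θ k} (c k same)) (c′ k same)))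
          where
          k : Fin (2 + n)
          k = fromℕ< {suc j} (s≤s (ℕₚ.m<n⇒m<1+n j<n))
          k≡ : toℕ k ≡ suc j
          k≡ = toℕ-fromℕ< (s≤s (ℕₚ.m<n⇒m<1+n j<n))
          same : M._≈_ (face Φ k) (face Φx k)
          same = agree k (λ e → j≢′ (ℕₚ.suc-injective (≡.trans (≡.sym k≡) e)))
                         (λ e → j≢  (ℕₚ.suc-injective (≡.trans (≡.sym k≡) e)))

        walk : ∀ Θ Θ′ → Star (λ Θ Θ′ → Adjacent Θ Θ′ × ContainsMeet Φ Φx Θ′) Θ Θ′ →
          ContainsMeet Φ Φx Θ → OnPolygon Θ → OnPolygon Θ′
        walk Θ _ [] _ on = on
        walk Θ Θ′ (_◅_ {j = Ξ} ((j , j<n , f) , c′) path) c on = walk Ξ Θ′ path c′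
          (onPolygon-flip Θ Ξ (flip-rank j<n Θ Ξ c c′ f) f on)

      -- Strong flag-connectedness gives a walk from `Φ` to `Φx` that stays on the polygon. Its end
      -- is `Φh` in the first alternative and `(Φh)ᵐ` in the second, where the `m`-face is the coset
      -- of `σ m ∙ h`.
      stable⇒power : ∃ λ h → Power h ×
        ( (∀ k → Stabilizer G n σ k (proj₁ x ∙ h ⁻¹))
        ⊎ (∀ k → toℕ k ≢ suc m → Stabilizer G n σ k (proj₁ x ∙ h ⁻¹))
          × (∀ k → toℕ k ≡ suc m → Stabilizer G n σ k (proj₁ x ∙ (σ m ∙ h) ⁻¹)))
      stable⇒power with IsPolytope.strongly-flag-connected isPolytope Φ Φx
      ... | Ψ , path , Ψ≋Φx with walk Φ Ψ path (λ k _ → M.refl {face Φ k})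
          ((ε , unit) , one , inj₁ λ k → M.refl {face Φ k})
      ...   | h , p , inj₁ e = proj₁ h , p , inj₁ λ k → proj₂
        (M.trans {face Φx k} {face Ψ k} {face (even h) k}
          (M.sym {face Ψ k} {face Φx k} (Ψ≋Φx k)) (e k))
      ...   | h , p , inj₂ e = proj₁ h , p , inj₂ (off , on)
        where
        Φx≋ : ∀ k → Stabilizer G n σ k (proj₁ x ∙ (proj₁ (choose (toℕ k ℕₚ.≟ suc m) h)) ⁻¹)
        Φx≋ k = proj₂ (M.trans {face Φx k} {face Ψ k} {face (odd h) k}
          (M.sym {face Ψ k} {face Φx k} (Ψ≋Φx k)) (e k))
        off : ∀ k → toℕ k ≢ suc m → Stabilizer G n σ k (proj₁ x ∙ proj₁ h ⁻¹)
        off k k≢ with toℕ k ℕₚ.≟ suc m | Φx≋ k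
        ... | yes k≡ | _ = ⊥-elim (k≢ k≡)
        ... | no _   | s = s
        on : ∀ k → toℕ k ≡ suc m → Stabilizer G n σ k (proj₁ x ∙ (σ m ∙ proj₁ h) ⁻¹)
        on k k≡ with toℕ k ℕₚ.≟ suc m | Φx≋ k
        ... | yes _ | s = s
        ... | no k≢ | _ = ⊥-elim (k≢ k≡)

-- Duality

-- This lets both coordinates of the mix act on the faces of the same polytope, where they can be
-- compared.
undual : {P : RankedStructure n a b r} → Automorphism (dualStructure P) → Automorphism P
undual {n = n} {P = P} α = record
  { bijection = bijection α
  ; to-mono   = to-mono α
  ; from-mono = from-mono α
  ; to-rank   = λ F → opposite-injective (to-rank α F)
  ; from-rank = λ F → opposite-injective (from-rank α F) }
  where
  opposite-injective : {k l : Fin (2 + n)} → opposite k ≡ opposite l → k ≡ l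
  opposite-injective {k} {l} e = ≡.trans (≡.sym (opposite-involutive k))
    (≡.trans (≡.cong opposite e) (opposite-involutive l))

module _ {P : RankedStructure n a b r} where
  private
    module A = Powers (Γ P)
    module D = Powers (Γ (dualStructure P))

  to-times-dual : ∀ k α F → to (k D.times dualAutomorphism α) F ≡ to (k A.times α) F
  to-times-dual zero    α F = ≡.refl
  to-times-dual (suc k) α F = to-times-dual k α (to α F)

-- The mix of a polytope of rank 2(2 + l) with its dual

module SelfDualMix {n l} (n≡ : n ≡ (2 + l) + (2 + l)) (P : BasedStructure n a b r)
  (isPolytope : IsPolytope (BasedStructure.structure P))
  (σ-rotation : ∀ i → 1 ≤ i → i < n →
    IsRotation (BasedStructure.base P) i (i ∸ 1) (BasedStructure.σ P i))
  where
  open BasedStructure P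
  open RankedStructure structure using () renaming (_≈_ to _≈ᶠ_)
  open Rotations isPolytope base
  open PolytopeFlips isPolytope using (rigid)

  m : ℕ
  m = 2 + l

  G : Group _ _
  G = DirectProduct.group (Γ structure) (Γ (dualStructure structure))

  β : ℕ → Group.Carrier G
  β i = σ i , BasedStructure.σ (P ᵟ) i

  private
    module A = Group (Γ structure)
    module Aᵖ = Powers (Γ structure)
    module D = Group (Γ (dualStructure structure))
    module Dᵖ = Powers (Γ (dualStructure structure))
    module G = Group G
    module S = Setoid (RankedStructure.faces structure)

  m+1<n : suc m < n
  m+1<n = ≡.subst (suc m <_) (≡.sym n≡) (s≤s (s≤s (ℕₚ.m≤n+m m l)))

  m<n : m < n
  m<n = ℕₚ.<-trans (ℕₚ.n<1+n _) m+1<n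

  m-1<n : suc l < n
  m-1<n = ℕₚ.<-trans (ℕₚ.n<1+n _) m<n

  n∸m≡m : n ∸ m ≡ m
  n∸m≡m = ≡.trans (≡.cong (_∸ m) n≡) (ℕₚ.m+n∸m≡n m m)

  n∸[m-1]≡m+1 : n ∸ suc l ≡ suc m
  n∸[m-1]≡m+1 = ≡.trans (≡.cong (_∸ suc l) (≡.trans n≡ (≡.sym (ℕₚ.+-suc (suc l) m))))
    (ℕₚ.m+n∸m≡n (suc l) (suc m))

  n∸[m+1]≡m-1 : n ∸ suc m ≡ suc l
  n∸[m+1]≡m-1 = ≡.trans (≡.cong (_∸ suc m) (≡.trans n≡ (ℕₚ.+-suc m (suc l))))
    (ℕₚ.m+n∸m≡n (suc m) (suc l))

  proj₁-homo : GroupMorphisms.IsGroupHomomorphism G.rawGroup A.rawGroup proj₁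
  proj₁-homo = record
    { isMonoidHomomorphism = record
      { isMagmaHomomorphism = record
        { isRelHomomorphism = record { cong = proj₁ }
        ; homo = λ _ _ _ → S.refl }
      ; ε-homo = λ _ → S.refl }
    ; ⁻¹-homo = λ _ _ → S.refl }

  act₂ : G.Carrier → Automorphism structure
  act₂ g = undual (proj₂ g)

  act₂-homo : GroupMorphisms.IsGroupHomomorphism G.rawGroup A.rawGroup act₂
  act₂-homo = record
    { isMonoidHomomorphism = record
      { isMagmaHomomorphism = record
        { isRelHomomorphism = record { cong = proj₂ }
        ; homo = λ _ _ _ → S.refl }
      ; ε-homo = λ _ → S.refl }
    ; ⁻¹-homo = λ _ _ → S.refl }

  corank<n : ∀ {j} → j < n → n ∸ suc j < n
  corank<n j<n = ℕₚ.∸-monoʳ-< (s≤s z≤n) j<n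

  -- `σ (n ∸ i)` flips rank `n - i` and then `n - i - 1`, and inversion swaps the order. These are
  -- the dual ranks of `i - 1` and `i`.
  act₂-rotation : ∀ i → 1 ≤ i → i < n →
    IsRotation base (n ∸ suc i) (n ∸ suc (i ∸ 1)) (act₂ (β i))
  act₂-rotation (suc i) (s≤s z≤n) i<n = ≡.subst
    (λ j → IsRotation base j (n ∸ suc i) (act₂ (β (suc i)))) corank
    (rotation-⁻¹ (σ (n ∸ suc i)) (σ-rotation (n ∸ suc i) (ℕₚ.m<n⇒0<n∸m i<n)
      (corank<n (ℕₚ.<-trans (ℕₚ.n<1+n i) i<n))))
    where
    corank : n ∸ suc i ∸ 1 ≡ n ∸ suc (suc i)
    corank = ≡.trans (ℕₚ.∸-+-assoc n (suc i) 1) (≡.cong (n ∸_) (ℕₚ.+-comm (suc i) 1))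

  private
    module Act₁ = Action isPolytope base G proj₁ proj₁-homo β (λ j → j) (λ j<n → j<n) σ-rotation
    module Act₂ = Action isPolytope base G act₂ act₂-homo β (λ j → n ∸ suc j) corank<n act₂-rotation

  stabilizer-fixes₁ : ∀ k {g} → Stabilizer G n β k g →
    to (proj₁ g) (face base k) ≈ᶠ face base k
  stabilizer-fixes₁ k = Act₁.stabilizer-fixes k k λ _ _ → ≡.sym

  -- Duality sends rank `j` to `n - 1 - j`, hence `opposite`.
  stabilizer-fixes₂ : ∀ k {g} → Stabilizer G n β (opposite k) g →
    to (act₂ g) (face base k) ≈ᶠ face base k
  stabilizer-fixes₂ k = Act₂.stabilizer-fixes (opposite k) k corank-eq
    where
    corank-eq : ∀ j → j < n → toℕ k ≡ suc (n ∸ suc j) → suc j ≡ toℕ (opposite k)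
    corank-eq j j<n e = ≡.sym (≡.trans (opposite-prop k) (≡.trans (≡.cong (suc n ∸_) e)
      (ℕₚ.m∸[m∸n]≡n j<n)))

  -- The middle generator is paired with its own inverse, because `n - m = m`.
  act₂-βm : act₂ (β m) A.≈ σ m A.⁻¹
  act₂-βm F = S.reflexive (≡.cong (λ i → from (σ i) F) n∸m≡m)

  x : G.Carrier
  x = A.ε , proj₂ (β m) D.∙ proj₂ (β m)

  σ-pair-involution : ∀ i → 2 + i < n → (σ (suc i) A.∙ σ (2 + i)) A.∙ (σ (suc i) A.∙ σ (2 + i)) A.≈ A.ε
  σ-pair-involution i i<n = half-turn (σ (suc i) A.∙ σ (2 + i)) i<n
    (rotation-∙ (σ (suc i)) (σ (2 + i)) (ℕₚ.<-trans (ℕₚ.n<1+n _) i<n)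
      (σ-rotation (suc i) (s≤s z≤n) (ℕₚ.<-trans (ℕₚ.n<1+n _) i<n))
      (σ-rotation (2 + i) (s≤s z≤n) i<n))

  dual-order : ∀ i q → q Aᵖ.times σ (n ∸ i) A.≈ A.ε →
    q Dᵖ.times proj₂ (β i) D.≈ D.ε
  dual-order i q e = D.trans {q Dᵖ.times proj₂ (β i)} {(q Dᵖ.times α) D.⁻¹} {D.ε}
    (Dᵖ.times-⁻¹ α q)
    (D.trans {(q Dᵖ.times α) D.⁻¹} {D.ε D.⁻¹} {D.ε}
      (D.⁻¹-cong {q Dᵖ.times α} {D.ε} λ F →
        S.trans (S.reflexive (to-times-dual q (σ (n ∸ i)) F)) (e F))
      (GroupProperties.ε⁻¹≈ε (Γ (dualStructure structure))))
    where
    α : Automorphism (dualStructure structure)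
    α = dualAutomorphism (σ (n ∸ i))

  βm-moves-m-1 : ∀ k → toℕ k ≡ m → ¬ Stabilizer G n β k (β m)
  βm-moves-m-1 k k≡ s = rotation-moves-second (σ m) ℕₚ.1+n≢n
    (σ-rotation m (s≤s z≤n) m<n) k k≡ (stabilizer-fixes₁ k s)

  βm-moves-m : ∀ k → toℕ k ≡ suc m → ¬ Stabilizer G n β k (β m)
  βm-moves-m k k≡ s = rotation-moves-first (σ m) ℕₚ.1+n≢n
    (σ-rotation m (s≤s z≤n) m<n) k k≡ (stabilizer-fixes₁ k s)

  open CosetPolygon G n β l m<n βm-moves-m-1 βm-moves-m using (Power; one; times; over; stable⇒power)

  power-commutes : ∀ {h} → Power h → σ m A.∙ proj₁ h A.≈ proj₁ h A.∙ σ m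
  power-commutes one F = S.refl
  power-commutes (times p) F = power-commutes p (to (σ m) F)
  power-commutes (over {h} p) F = S.trans
    (to-cong (proj₁ h) (S.trans (strictlyInverseʳ (σ m) F) (S.sym (strictlyInverseˡ (σ m) F))))
    (power-commutes p (from (σ m) F))

  -- A power of `β m` has opposite powers of `σ m` as its coordinates, so if the first is trivial,
  -- so is the second.
  power-opposite : ∀ {h} → Power h → proj₁ h A.∙ act₂ h A.≈ A.ε
  power-opposite one F = S.refl
  power-opposite (times {h} p) F = S.trans
    (to-cong (proj₂ h) (S.trans (act₂-βm _)
      (S.trans (from-cong (σ m) (power-commutes p F)) (strictlyInverseʳ (σ m) _))))
    (power-opposite p F)
  power-opposite (over {h} p) F = S.trans
    (to-cong (proj₂ h) (S.trans
      (A.⁻¹-cong {act₂ (β m)} {σ m A.⁻¹} act₂-βm (to (proj₁ h) (from (σ m) F)))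
      (S.trans (S.sym (power-commutes p (from (σ m) F)))
        (to-cong (proj₁ h) (strictlyInverseˡ (σ m) F)))))
    (power-opposite p F)

  -- The first coordinate of `x` is trivial, so a stabilizer containing `x ∙ h ⁻¹` gives a face
  -- fixed by the inverse of `proj₁ h`; this transfers it to `proj₁ h`.
  inverse-fixes : ∀ (α : Automorphism structure) {F} → from α F ≈ᶠ F → to α F ≈ᶠ F
  inverse-fixes α {F} e = S.trans (to-cong α (S.sym e)) (strictlyInverseˡ α F)

  module _ {p q} (coprime : Coprime p q)
    (order-p : p Aᵖ.times σ (suc l) A.≈ A.ε)
    (order-q : q Aᵖ.times σ (suc m) A.≈ A.ε) where

    -- `S` is arbitrary because `x` must be shown to lie both in the whole mix and in stabilizers.
    x∈⟨βm-1,βm⟩ : ∀ {s} {S : Pred G.Carrier s} →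
      ⟨_⟩ G S (β (suc l)) → ⟨_⟩ G S (β m) → ⟨_⟩ G S x
    x∈⟨βm-1,βm⟩ βm-1 βm = resp (σ-pair-involution l m<n , λ _ → S.refl) (mul y y)
      where
      y = mul (coprime-split (Γ structure) (Γ (dualStructure structure))
        {u = σ (suc l)} {proj₂ (β (suc l))} coprime order-p
        (dual-order (suc l) q (≡.subst (λ i → q Aᵖ.times σ i A.≈ A.ε)
          (≡.sym n∸[m-1]≡m+1) order-q)) βm-1) βm

    x∈⟨βm,βm+1⟩ : ∀ {s} {S : Pred G.Carrier s} →
      ⟨_⟩ G S (β m) → ⟨_⟩ G S (β (suc m)) → ⟨_⟩ G S x
    x∈⟨βm,βm+1⟩ βm βm+1 = resp (σ-pair-involution (suc l) m+1<n , λ _ → S.refl) (mul y y)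
      where
      y = mul βm (coprime-split (Γ structure) (Γ (dualStructure structure))
        {u = σ (suc m)} {proj₂ (β (suc m))} (Coprimality.sym coprime) order-q
        (dual-order (suc m) p (≡.subst (λ i → p Aᵖ.times σ i A.≈ A.ε)
          (≡.sym n∸[m+1]≡m-1) order-p)) βm+1)

    -- `β (suc l)` and `β m` belong to the ranks `m - 2`, `m - 1` and `m`, so they serve for every
    -- `k` except the code `suc l` of rank `m - 2`. There `β m` and `β (suc m)` take over, which
    -- belong to the ranks `m - 1`, `m` and `m + 1`.
    x∈stabilizer : ∀ k → toℕ k ≢ m → toℕ k ≢ suc m → Stabilizer G n β k x
    x∈stabilizer k k≢m k≢m+1 with toℕ k ℕₚ.≟ suc l
    ... | no k≢m-1 = x∈⟨βm-1,βm⟩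
      (generator∈stabilizer G n β l k m-1<n k≢m-1 k≢m)
      (generator∈stabilizer G n β (suc l) k m<n k≢m k≢m+1)
    ... | yes k≡ = x∈⟨βm,βm+1⟩
      (generator∈stabilizer G n β (suc l) k m<n k≢m k≢m+1)
      (generator∈stabilizer G n β m k m+1<n k≢m+1
        λ e → ℕₚ.m≢1+n+m (suc l) {2} (≡.trans (≡.sym k≡) e))

    σm-involution : IsPolytope (P ◇ P ᵟ) → σ m A.∙ σ m A.≈ A.ε
    σm-involution mix-isPolytope with stable⇒power mix-isPolytope
      (x , x∈⟨βm-1,βm⟩
             (gen (suc l , s≤s z≤n , m-1<n , G.refl {β (suc l)}))
             (gen (m , s≤s z≤n , m<n , G.refl {β m})))
      x∈stabilizer
    -- Here `Φx = (Φh)ᵐ`. As `x` is trivial in the first coordinate, `proj₁ h` acts on the base flag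
    -- as the reflection at rank `m`.
    ... | h , pow , inj₂ (off , on) = commuting-reflection (σ m) (proj₁ h) ℕₚ.1+n≢n m<n m-1<n
      (σ-rotation m (s≤s z≤n) m<n) (power-commutes pow)
      (λ k k≢ → inverse-fixes (proj₁ h) (stabilizer-fixes₁ k (off k k≢)))
      (λ k k≡ → inverse-fixes (σ m A.∙ proj₁ h) (stabilizer-fixes₁ k (on k k≡)))
    -- Here `Φx = Φh`. The first coordinate makes `h` trivial in both, and then the second says that
    -- `σₘ⁻²` fixes the base flag.
    ... | h , pow , inj₁ stable = rigid base (σ m A.∙ σ m) λ k → inverse-fixes (σ m A.∙ σ m)
      (S.trans (S.sym (S.trans (act₂-βm _) (from-cong (σ m) (act₂-βm _)))) (square-fixes k))
      where
      h₁-trivial : ∀ F → to (proj₁ h) F ≈ᶠ F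
      h₁-trivial = rigid base (proj₁ h)
        λ k → inverse-fixes (proj₁ h) (stabilizer-fixes₁ k (stable k))

      h₂-trivial : ∀ F → to (act₂ h) F ≈ᶠ F
      h₂-trivial F = S.trans (to-cong (act₂ h) (S.sym (h₁-trivial F))) (power-opposite pow F)

      square-fixes : ∀ k → to (act₂ x) (face base k) ≈ᶠ face base k
      square-fixes k = S.trans (S.sym (strictlyInverseˡ (act₂ h) _))
        (S.trans (h₂-trivial _) (stabilizer-fixes₂ k (stable (opposite k))))

-- Rotations in chiral and directly regular polytopes, and the theorem

module _ {n} (P : BasedStructure n a b r) where
  open BasedStructure P
  private
    module S = Setoid (RankedStructure.faces structure)

  polytope : IsChiral P ⊎ IsDirectlyRegular P → IsPolytope structure
  polytope (inj₁ chiral)  = IsChiral.isPolytope chiral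
  polytope (inj₂ regular) = IsDirectlyRegular.isPolytope regular

  -- In the regular case `ρ i` carries the `(i - 1)`-flip from `Φ` to `Φρᵢ₋₁` to one from `Φρᵢ` to
  -- `Φσᵢ`, and `Φρᵢ = Φⁱ`.
  base-rotation : IsChiral P ⊎ IsDirectlyRegular P →
    ∀ i → 1 ≤ i → i < n → IsRotation base i (i ∸ 1) (σ i)
  base-rotation (inj₁ chiral)  i 1≤i i<n = IsChiral.σ-base chiral i 1≤i i<n
  base-rotation (inj₂ regular) i 1≤i i<n = base · ρ i , ρ-base i i<n
    , flip-resp (base · ρ i) (base · ρ i) (base · ρ (i ∸ 1) · ρ i) (base · σ i)
        (λ _ → S.refl) (λ k → S.sym (σ-def i 1≤i i<n (face base k)))
        (flip-· base (base · ρ (i ∸ 1)) (ρ i)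
          (ρ-base (i ∸ 1) (ℕₚ.≤-<-trans (ℕₚ.m∸n≤m i 1) i<n)))
    where open IsDirectlyRegular regular

coprime⁺-finite : ∀ k l → Coprime⁺ k l → ∃ λ p → ∃ λ q → k ≡ [ p ] × l ≡ [ q ] × Coprime p q
coprime⁺-finite [ p ] [ q ] c = p , q , ≡.refl , ≡.refl , c
coprime⁺-finite [ _ ] ⊤⁺    ()
coprime⁺-finite ⊤⁺    _     ()

order≥3⇒square≉ε : (G : Group c ℓ) → let open Group G in
  ∀ g k → HasOrder G g k → [ 3 ] ≤⁺ k → ¬ (g ∙ g ≈ ε)
order≥3⇒square≉ε G g k order 3≤k e = absurd k order 3≤k
  where
  open Group G
  open RawMonoidDefs rawMonoid using () renaming (_×_ to _times_)
  square : 2 times g ≈ ε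
  square = trans (∙-congˡ (identityʳ g)) e
  absurd : ∀ k → HasOrder G g k → [ 3 ] ≤⁺ k → ⊥
  absurd [ k ] (_ , _ , least) SupremumOrder.[ 3≤k ] =
    ℕₚ.<⇒≱ 3≤k (least 2 (s≤s z≤n) square)
  absurd ⊤⁺ infinite _ = infinite 2 (s≤s z≤n) square

theorem4p2 : ∀ {a b r} (n m : ℕ) → 4 ≤ n → n ≡ 2 * m →
    (P : BasedStructure n a b r) → IsChiral P ⊎ IsDirectlyRegular P →
    (p : ℕ → ℕ ⁺) → HasType P p →
    Coprime⁺ (p (m ∸ 1)) (p (m + 1)) → [ 3 ] ≤⁺ p m →
    ¬ IsPolytope (P ◇ P ᵟ)
theorem4p2 .0 zero () ≡.refl
theorem4p2 .2 (suc zero) (s≤s (s≤s ())) ≡.refl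
theorem4p2 n (suc (suc l)) _ n≡ P chiral-or-regular p type coprime⁺ 3≤pm mix-isPolytope
  with coprime⁺-finite (p (suc l)) (p (2 + l + 1)) coprime⁺
... | k , k′ , pm-1≡ , pm+1≡ , coprime =
  order≥3⇒square≉ε (Γ structure) (σ (2 + l)) (p (2 + l)) (type (2 + l) (s≤s z≤n) m<n) 3≤pm
    (σm-involution coprime (finite-order l m-1<n k pm-1≡)
      (finite-order (2 + l) m+1<n k′ (≡.trans (≡.cong p (ℕₚ.+-comm 1 (2 + l))) pm+1≡))
      mix-isPolytope)
  where
  open BasedStructure P
  open SelfDualMix {l = l} (≡.trans n≡ (≡.cong (2 + l +_) (ℕₚ.+-identityʳ (2 + l)))) P
    (polytope P chiral-or-regular) (base-rotation P chiral-or-regular)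

  finite-order : ∀ i → suc i < n → ∀ k → p (suc i) ≡ [ k ] →
    Group._≈_ (Γ structure) (RawMonoidDefs._×_ (Group.rawMonoid (Γ structure)) k (σ (suc i)))
      (Group.ε (Γ structure))
  finite-order i i<n k e with p (suc i) | type (suc i) (s≤s z≤n) i<n
  finite-order i i<n k ≡.refl | _ | _ , power , _ = power
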